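{- The type-structure $\mathcal C^{=}=(\mathcal C^=_\sigma)_\sigma$, where $\mathcal C^=_\sigma:=\{x\in\mathcal S_\sigma:\ \mathcal S^\omega_*\models\exists\boldsymbol a\,\forall\boldsymbol b\,\langle\mathcal I_\sigma(x)\rangle^{\boldsymbol a}_{\boldsymbol b}\}$ with $\langle\cdot\rangle$ the canonical-upon-precise interpretation, is a model of Gödel's theory $\mathsf T$.
   Context: Types: finite types are generated by $\sigma\to\tau$ from the ground types $\mathbb N$, $\mathbb B$ (Booleans); star types allow in addition $\sigma\mapsto\sigma^*$. $\mathcal S^\omega_*$ is the full set-theoretic structure: $\mathcal S_{\mathbb N}=\mathbb N$, $\mathcal S_{\mathbb B}=\{0,1\}$, $\mathcal S_{\rho\to\sigma}$ is the set of all functions from $\mathcal S_\rho$ to $\mathcal S_\sigma$, $\mathcal S_{\sigma^*}$ the set of all non-empty finite subsets of $\mathcal S_\sigma$. Boldface letters are (possibly empty) tuples; $\forall\boldsymbol b\in\boldsymbol B$ means $\forall b_1\in B_1\cdots\forall b_n\in B_n$. For each finite type $\sigma$, tuples of star types $\boldsymbol\tau_\sigma^+,\boldsymbol\tau_\sigma^-$ and the relation $\langle\mathcal I_\sigma(x)\rangle^{\boldsymbol a}_{\boldsymbol b}$ ($x:\sigma$, $\boldsymbol a:\boldsymbol\tau_\sigma^+$, $\boldsymbol b:\boldsymbol\tau_\sigma^-$) are defined by recursion: $\langle\mathcal I_{\mathbb N}(x)\rangle^n$ is $x=n$ ($\tau^+_{\mathbb N}=\mathbb N$, $\boldsymbol\tau^-_{\mathbb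 N}$ empty); $\langle\mathcal I_{\mathbb B}(i)\rangle^j$ is $i=j$ ($\tau^+_{\mathbb B}=\mathbb B$, $\boldsymbol\tau^-_{\mathbb B}$ empty); and $$\langle\mathcal I_{\rho\to\sigma}(h)\rangle^{\boldsymbol f,\boldsymbol g}_{\boldsymbol a,\boldsymbol d}:\equiv\forall x^\rho(\forall\boldsymbol b\in\boldsymbol g\boldsymbol a\boldsymbol d\,\langle\mathcal I_\rho(x)\rangle^{\boldsymbol a}_{\boldsymbol b}\to\langle\mathcal I_\sigma(hx)\rangle^{\boldsymbol f\boldsymbol a}_{\boldsymbol d}),$$ where $\boldsymbol a:\boldsymbol\tau^+_\rho$, $\boldsymbol d:\boldsymbol\tau^-_\sigma$, $\boldsymbol f$ maps $\boldsymbol\tau_\rho^+$ to $\boldsymbol\tau_\sigma^+$, and $\boldsymbol g$ maps $\boldsymbol\tau_\rho^+,\boldsymbol\tau_\sigma^-$ to tuples of non-empty finite sets of elements of the types $\boldsymbol\tau_\rho^-$. Gödel's $\mathsf T$ is the quantifier-free theory of primitive recursive functionals over the arithmetical types (generated from $\mathbb N$ by $\to$), with constants the combinators $\Pi,\Sigma$, $0$, successor $\mathsf S$ and recursors $\mathsf R_\sigma$ ($\mathsf R0wf=w$, $\mathsf R(\mathsf Sn)wf=fn(\mathsf Rnwf)$). That a family $\mathcal C_\sigma\subseteq\mathcal S_\sigma$ is a model of $\mathsf T$ means: $\mathcal C_{\mathbb N}=\mathbb N$, the family is closed under application and contains the set-theoretic combinators, zero, successor and recursors of arithmetical type, which interpret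 the constants of $\mathsf T$ (so that the axioms of $\mathsf T$ hold). -}

module Defs where

open import Data.Bool.Properties using () renaming (≡-setoid to 𝔹-setoid)
open import Data.List.Base using (List; []; _∷_; _++_; foldr; map)
open import Data.List.Membership.Setoid using () renaming (_∈_ to Mem)
open import Data.List.NonEmpty.Base using (List⁺; toList)
open import Data.List.Relation.Binary.Subset.Setoid using () renaming (_⊆_ to Sub)
open import Data.List.Relation.Unary.All using (All; []; _∷_)
open import Data.List.Relation.Unary.All.Properties using (++⁺; ++⁻)
open import Data.Nat.Base using (ℕ; zero; suc)
open import Data.Product.Base using (_×_; _,_; proj₁; proj₂; ∃-syntax)
open import Data.Unit.Base using (⊤)
open import Function.Base using (id)
open import Function.Bundles using (Func; _⟨$⟩_)
open import Function.Relation.Binary.Setoid.Equality using (_⇨_)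
open import Level using (0ℓ)
open import Relation.Binary.Bundles using (Setoid)
open import Relation.Binary.Definitions using (_Respects_)
open import Relation.Binary.PropositionalEquality as ≡ using (_≡_; setoid)
open import Relation.Unary using (Pred; _∈_)

infixr 6 _⇒_ _⇒*_
infix  7 _⋆

data FinType : Set where
  nat bool : FinType
  _⇒_      : FinType → FinType → FinType

data Arithmetical : FinType → Set where
  nat : Arithmetical nat
  _⇒_ : ∀ {ρ σ} → Arithmetical ρ → Arithmetical σ → Arithmetical (ρ ⇒ σ)

data StarType : Set where
  nat bool : StarType
  _⇒_      : StarType → StarType → StarType
  _⋆       : StarType → StarType

⌊_⌋ : FinType → StarType
⌊ nat ⌋   = nat
⌊ bool ⌋  = bool
⌊ ρ ⇒ σ ⌋ = ⌊ ρ ⌋ ⇒ ⌊ σ ⌋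

-- A non-empty finite subset is a non-empty list up to mutual inclusion,
-- so the order and the multiplicity of the entries are not observable.

FinSubset : Setoid 0ℓ 0ℓ → Setoid 0ℓ 0ℓ
FinSubset A = record
  { Carrier = List⁺ (Setoid.Carrier A)
  ; _≈_ = λ B C → Sub A (toList B) (toList C) × Sub A (toList C) (toList B)
  ; isEquivalence = record
    { refl  = id , id
    ; sym   = λ (p , q) → q , p
    ; trans = λ (p , q) (p′ , q′) → (λ m → p′ (p m)) , (λ m → q (q′ m))
    }
  }

-- The full set-theoretic structure.  Sets are rendered as setoids, whose
-- equivalence plays the role of set-theoretic identity; a function between
-- sets is therefore an equivalence-preserving map, and functions are equal
-- when they are pointwise equal.

𝒮 : StarType → Setoid 0ℓ 0ℓ
𝒮 nat     = setoid ℕ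
𝒮 bool    = 𝔹-setoid
𝒮 (ρ ⇒ σ) = 𝒮 ρ ⇨ 𝒮 σ
𝒮 (σ ⋆)   = FinSubset (𝒮 σ)

El : StarType → Set
El t = Setoid.Carrier (𝒮 t)

⟦_⟧ : FinType → Set
⟦ σ ⟧ = El ⌊ σ ⌋

Eq : ∀ σ → ⟦ σ ⟧ → ⟦ σ ⟧ → Set
Eq σ = Setoid._≈_ (𝒮 ⌊ σ ⌋)

syntax Eq σ x y = x ≈[ σ ] y

Tuple : List StarType → Set
Tuple = All El

-- Functions of tuples are curried: (t₁ ∷ … ∷ tₙ ∷ []) ⇒* t is t₁ ⇒ … ⇒ tₙ ⇒ t.

_⇒*_ : List StarType → StarType → StarType
ts ⇒* t = foldr _⇒_ t ts

apply : ∀ {as} t → El (as ⇒* t) → Tuple as → El t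
apply t f []       = f
apply t f (a ∷ as) = apply t (f ⟨$⟩ a) as

applyTuple : ∀ {as} ts → Tuple (map (as ⇒*_) ts) → Tuple as → Tuple ts
applyTuple []       []       as = []
applyTuple (t ∷ ts) (f ∷ fs) as = apply t f as ∷ applyTuple ts fs as

-- b₁ ∈ B₁, …, bₙ ∈ Bₙ, where membership is taken up to the equality of 𝒮.

_∈ᵗ_ : ∀ {ts} → Tuple ts → Tuple (map _⋆ ts) → Set
_∈ᵗ_ {[]}     []       []       = ⊤
_∈ᵗ_ {t ∷ ts} (b ∷ bs) (B ∷ Bs) = Mem (𝒮 t) b (toList B) × (bs ∈ᵗ Bs)

mutual
  τ⁺ : FinType → List StarType
  τ⁺ nat     = nat ∷ []
  τ⁺ bool    = bool ∷ []
  τ⁺ (ρ ⇒ σ) = map (τ⁺ ρ ⇒*_) (τ⁺ σ)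
            ++ map ((τ⁺ ρ ++ τ⁻ σ) ⇒*_) (map _⋆ (τ⁻ ρ))

  τ⁻ : FinType → List StarType
  τ⁻ nat     = []
  τ⁻ bool    = []
  τ⁻ (ρ ⇒ σ) = τ⁺ ρ ++ τ⁻ σ

-- ℐ σ x a b is the relation ⟨ℐ_σ(x)⟩ with upper tuple a and lower tuple b.

ℐ : ∀ σ → ⟦ σ ⟧ → Tuple (τ⁺ σ) → Tuple (τ⁻ σ) → Set
ℐ nat     x (n ∷ []) [] = x ≡ n
ℐ bool    i (j ∷ []) [] = i ≡ j
ℐ (ρ ⇒ σ) h fg ad =
  let f , g = ++⁻ (map (τ⁺ ρ ⇒*_) (τ⁺ σ)) fg
      a , d = ++⁻ (τ⁺ ρ) ad
  in  ∀ (x : ⟦ ρ ⟧) →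
      (∀ (b : Tuple (τ⁻ ρ)) →
         b ∈ᵗ applyTuple (map _⋆ (τ⁻ ρ)) g (++⁺ a d) → ℐ ρ x a b) →
      ℐ σ (h ⟨$⟩ x) (applyTuple (τ⁺ σ) f a) d

𝒞⁼ : ∀ σ → Pred ⟦ σ ⟧ 0ℓ
𝒞⁼ σ x = ∃[ a ] ∀ b → ℐ σ x a b

module _ (A B : Setoid 0ℓ 0ℓ) where
  open Setoid using (Carrier; refl)

  Π-func : Carrier (A ⇨ B ⇨ A)
  Π-func = record
    { to = λ x → record { to = λ _ → x ; cong = λ _ → refl A }
    ; cong = λ x≈x′ _ → x≈x′
    }

  module _ (C : Setoid 0ℓ 0ℓ) where
    open Func

    Σ-func : Carrier ((A ⇨ B ⇨ C) ⇨ (A ⇨ B) ⇨ A ⇨ C)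
    Σ-func = record
      { to = λ x → record
        { to = λ y → record
          { to = λ z → x ⟨$⟩ z ⟨$⟩ (y ⟨$⟩ z)
          ; cong = λ {z} {z′} z≈z′ → Setoid.trans C
              (cong (x ⟨$⟩ z) (cong y z≈z′))
              (cong x z≈z′ (y ⟨$⟩ z′))
          }
        ; cong = λ y≈y′ z → cong (x ⟨$⟩ z) (y≈y′ z)
        }
      ; cong = λ x≈x′ y z → x≈x′ z (y ⟨$⟩ z)
      }

module _ (A : Setoid 0ℓ 0ℓ) where
  open Setoid A
  open Func

  rec : ℕ → Carrier → Setoid.Carrier (setoid ℕ ⇨ A ⇨ A) → Carrier
  rec zero    w f = w
  rec (suc n) w f = f ⟨$⟩ n ⟨$⟩ rec n w f

  rec-cong₁ : ∀ n {w w′} f → w ≈ w′ → rec n w f ≈ rec n w′ f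
  rec-cong₁ zero    f w≈w′ = w≈w′
  rec-cong₁ (suc n) f w≈w′ = cong (f ⟨$⟩ n) (rec-cong₁ n f w≈w′)

  rec-cong₂ : ∀ n w {f f′} → Setoid._≈_ (setoid ℕ ⇨ A ⇨ A) f f′ →
              rec n w f ≈ rec n w f′
  rec-cong₂ zero    w f≈f′ = refl
  rec-cong₂ (suc n) w {f} {f′} f≈f′ =
    trans (cong (f ⟨$⟩ n) (rec-cong₂ n w f≈f′)) (f≈f′ n (rec n w f′))

  R-func : Setoid.Carrier (setoid ℕ ⇨ A ⇨ (setoid ℕ ⇨ A ⇨ A) ⇨ A)
  R-func = record
    { to = λ n → record
      { to = λ w → record
        { to = rec n w ; cong = λ f≈f′ → rec-cong₂ n w f≈f′ }
      ; cong = λ w≈w′ f → rec-cong₁ n f w≈w′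
      }
    ; cong = λ { ≡.refl _ _ → refl }
    }

𝚷 : ∀ ρ σ → ⟦ ρ ⇒ σ ⇒ ρ ⟧
𝚷 ρ σ = Π-func (𝒮 ⌊ ρ ⌋) (𝒮 ⌊ σ ⌋)

𝚺 : ∀ ρ σ τ → ⟦ (ρ ⇒ σ ⇒ τ) ⇒ (ρ ⇒ σ) ⇒ ρ ⇒ τ ⟧
𝚺 ρ σ τ = Σ-func (𝒮 ⌊ ρ ⌋) (𝒮 ⌊ σ ⌋) (𝒮 ⌊ τ ⌋)

𝟎 : ⟦ nat ⟧
𝟎 = zero

𝐒 : ⟦ nat ⇒ nat ⟧
𝐒 = record { to = suc ; cong = ≡.cong suc }

𝐑 : ∀ σ → ⟦ nat ⇒ σ ⇒ (nat ⇒ σ ⇒ σ) ⇒ σ ⟧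
𝐑 σ = R-func (𝒮 ⌊ σ ⌋)

-- A family of subsets of the full structure that is a model of Gödel's T.
-- A subset of a setoid has to respect its equality.  The successor axioms and
-- induction need no clause, since the ground type is interpreted by all of ℕ
-- and 𝟎, 𝐒 are the actual zero and successor.

record IsModelOfT (𝒞 : ∀ σ → Pred ⟦ σ ⟧ 0ℓ) : Set where
  field
    respects : ∀ σ → 𝒞 σ Respects Eq σ

    nat-full : ∀ n → n ∈ 𝒞 nat
    app-closed : ∀ ρ σ {h : ⟦ ρ ⇒ σ ⟧} {x : ⟦ ρ ⟧} →
                 h ∈ 𝒞 (ρ ⇒ σ) → x ∈ 𝒞 ρ → h ⟨$⟩ x ∈ 𝒞 σ

    𝚷∈ : ∀ {ρ σ} → Arithmetical ρ → Arithmetical σ → 𝚷 ρ σ ∈ 𝒞 (ρ ⇒ σ ⇒ ρ)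
    𝚺∈ : ∀ {ρ σ τ} → Arithmetical ρ → Arithmetical σ → Arithmetical τ →
         𝚺 ρ σ τ ∈ 𝒞 ((ρ ⇒ σ ⇒ τ) ⇒ (ρ ⇒ σ) ⇒ ρ ⇒ τ)
    𝟎∈ : 𝟎 ∈ 𝒞 nat
    𝐒∈ : 𝐒 ∈ 𝒞 (nat ⇒ nat)
    𝐑∈ : ∀ {σ} → Arithmetical σ → 𝐑 σ ∈ 𝒞 (nat ⇒ σ ⇒ (nat ⇒ σ ⇒ σ) ⇒ σ)

    𝚷-eq : ∀ {ρ σ} → Arithmetical ρ → Arithmetical σ →
           ∀ {x y} → x ∈ 𝒞 ρ → y ∈ 𝒞 σ →
           (𝚷 ρ σ ⟨$⟩ x ⟨$⟩ y) ≈[ ρ ] x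
    𝚺-eq : ∀ {ρ σ τ} → Arithmetical ρ → Arithmetical σ → Arithmetical τ →
           ∀ {x y z} → x ∈ 𝒞 (ρ ⇒ σ ⇒ τ) → y ∈ 𝒞 (ρ ⇒ σ) → z ∈ 𝒞 ρ →
           (𝚺 ρ σ τ ⟨$⟩ x ⟨$⟩ y ⟨$⟩ z) ≈[ τ ] (x ⟨$⟩ z ⟨$⟩ (y ⟨$⟩ z))
    𝐑-zero : ∀ {σ} → Arithmetical σ →
             ∀ {w f} → w ∈ 𝒞 σ → f ∈ 𝒞 (nat ⇒ σ ⇒ σ) →
             (𝐑 σ ⟨$⟩ 𝟎 ⟨$⟩ w ⟨$⟩ f) ≈[ σ ] w
    𝐑-suc : ∀ {σ} → Arithmetical σ →
            ∀ {n w f} → n ∈ 𝒞 nat → w ∈ 𝒞 σ → f ∈ 𝒞 (nat ⇒ σ ⇒ σ) →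
            (𝐑 σ ⟨$⟩ (𝐒 ⟨$⟩ n) ⟨$⟩ w ⟨$⟩ f)
              ≈[ σ ] (f ⟨$⟩ n ⟨$⟩ (𝐑 σ ⟨$⟩ n ⟨$⟩ w ⟨$⟩ f))

{-# OPTIONS --safe #-}
module Submission where

-- The relation ⟨ℐ_σ(x)⟩ is of Diller–Nahm type: a realizer of h : ρ ⇒ σ sends a
-- realizer of the argument to one of the value, and answers a challenge to the
-- value by a finite set of challenges to the argument.  Such realizers are closed
-- under the rules of the simply typed λ-calculus, provided that a term in context
-- answers each challenge with a finite set of challenges for every variable:
-- the uses of a variable in the two parts of an application are collected by a
-- finite union.  This yields 𝚷 and 𝚺.  For 𝐑, the numeral itself is its only
-- realizer, so a family of realizers of the values h n is a realizer of
-- h : nat ⇒ σ; each 𝐑 n is then a λ-term, by induction on n.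

open import Defs

open import Data.Bool.Base using (false)
open import Data.List.Base using (List; []; _∷_; _++_; map; concatMap; cartesianProductWith)
open import Data.List.Membership.Setoid using (find) renaming (_∈_ to Mem)
open import Data.List.Membership.Setoid.Properties
  using (∈-cartesianProductWith⁺; ∈-cartesianProductWith⁻; ∈-resp-≈)
open import Data.List.NonEmpty.Base using (toList; [_]; _⁺++_)
open import Data.List.Relation.Binary.Subset.Setoid using () renaming (_⊆_ to Sub)
open import Data.List.Relation.Unary.All as All using ([]; _∷_)
open import Data.List.Relation.Unary.All.Properties using (++⁺; ++⁻; ++↔)
open import Data.List.Relation.Unary.Any as Any using (here; there)
open import Data.List.Relation.Unary.Any.Properties using (++⁺ˡ; ++⁺ʳ; concatMap⁺; concatMap⁻)
  renaming (++⁻ to Any-++⁻)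
open import Data.Nat.Base using (zero; suc)
open import Data.Product.Base using (_×_; _,_; proj₁; proj₂)
open import Data.Product.Relation.Binary.Pointwise.NonDependent using (_×ₛ_)
open import Data.Sum.Base using (inj₁; inj₂)
open import Data.Unit.Base using (⊤; tt)
open import Data.Unit.Properties using () renaming (≡-setoid to ⊤-setoid)
open import Function.Bundles using (Func; _⟨$⟩_; Inverse)
open import Function.Relation.Binary.Setoid.Equality using (_⇨_)
open import Level using (0ℓ)
open import Relation.Binary.Bundles using (Setoid)
open import Relation.Binary.PropositionalEquality as ≡ using (_≡_)
open import Relation.Unary using (_∈_)

open Func using (cong)
open Setoid using (Carrier)

private
  variable
    as bs ts : List StarType
    ρ σ : FinType

-- Tuples and their componentwise equality.

infix 4 _≈ᵗ_

data _≈ᵗ_ : ∀ {ts} → Tuple ts → Tuple ts → Set where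
  []  : [] ≈ᵗ []
  _∷_ : ∀ {t ts} {a b : El t} {xs ys : Tuple ts} →
        Setoid._≈_ (𝒮 t) a b → xs ≈ᵗ ys → _≈ᵗ_ {t ∷ ts} (a ∷ xs) (b ∷ ys)

≈ᵗ-refl : {xs : Tuple ts} → xs ≈ᵗ xs
≈ᵗ-refl {xs = []}            = []
≈ᵗ-refl {t ∷ _} {xs = _ ∷ _} = Setoid.refl (𝒮 t) ∷ ≈ᵗ-refl

≈ᵗ-sym : {xs ys : Tuple ts} → xs ≈ᵗ ys → ys ≈ᵗ xs
≈ᵗ-sym []               = []
≈ᵗ-sym {t ∷ _} (p ∷ ps) = Setoid.sym (𝒮 t) p ∷ ≈ᵗ-sym ps

≈ᵗ-trans : {xs ys zs : Tuple ts} → xs ≈ᵗ ys → ys ≈ᵗ zs → xs ≈ᵗ zs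
≈ᵗ-trans []               []       = []
≈ᵗ-trans {t ∷ _} (p ∷ ps) (q ∷ qs) = Setoid.trans (𝒮 t) p q ∷ ≈ᵗ-trans ps qs

𝒯 : List StarType → Setoid 0ℓ 0ℓ
𝒯 ts = record
  { Carrier = Tuple ts
  ; _≈_ = _≈ᵗ_
  ; isEquivalence = record { refl = ≈ᵗ-refl ; sym = ≈ᵗ-sym ; trans = ≈ᵗ-trans }
  }

++⁺-cong : {xs xs′ : Tuple as} {ys ys′ : Tuple bs} →
           xs ≈ᵗ xs′ → ys ≈ᵗ ys′ → ++⁺ xs ys ≈ᵗ ++⁺ xs′ ys′
++⁺-cong []       qs = qs
++⁺-cong (p ∷ ps) qs = p ∷ ++⁺-cong ps qs

++⁻-cong : ∀ as {bs} {xs ys : Tuple (as ++ bs)} → xs ≈ᵗ ys →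
           Setoid._≈_ (𝒯 as ×ₛ 𝒯 bs) (++⁻ as xs) (++⁻ as ys)
++⁻-cong []       ps       = [] , ps
++⁻-cong (_ ∷ as) (p ∷ ps) = p ∷ proj₁ (++⁻-cong as ps) , proj₂ (++⁻-cong as ps)

++⁻∘++⁺ : (xs : Tuple as) (ys : Tuple bs) → ++⁻ as (++⁺ xs ys) ≡ (xs , ys)
++⁻∘++⁺ xs ys = Inverse.strictlyInverseʳ ++↔ (xs , ys)

++⁺∘++⁻ : ∀ as {bs} (xs : Tuple (as ++ bs)) → ++⁺ (proj₁ (++⁻ as xs)) (proj₂ (++⁻ as xs)) ≡ xs
++⁺∘++⁻ as xs = Inverse.strictlyInverseˡ (++↔ {xs = as}) xs

-- Currying of functions on tuples

apply-cong : ∀ t {f g : El (as ⇒* t)} {xs ys : Tuple as} →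
             Setoid._≈_ (𝒮 (as ⇒* t)) f g → xs ≈ᵗ ys →
             Setoid._≈_ (𝒮 t) (apply t f xs) (apply t g ys)
apply-cong t f≈g []       = f≈g
apply-cong {_ ∷ as} t {f} {g} f≈g (_∷_ {b = b} p ps) =
  apply-cong t (Setoid.trans (𝒮 (as ⇒* t)) (cong f p) (f≈g b)) ps

applyTuple-cong : ∀ ts {fs gs : Tuple (map (as ⇒*_) ts)} {xs ys : Tuple as} →
                  fs ≈ᵗ gs → xs ≈ᵗ ys → applyTuple ts fs xs ≈ᵗ applyTuple ts gs ys
applyTuple-cong []       []       qs = []
applyTuple-cong (t ∷ ts) (p ∷ ps) qs = apply-cong t p qs ∷ applyTuple-cong ts ps qs

fix-head : ∀ {a} t → El a → Func (𝒯 (a ∷ as)) (𝒮 t) → Func (𝒯 as) (𝒮 t)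
fix-head {a = a} t x F = record
  { to = λ xs → F ⟨$⟩ (x ∷ xs) ; cong = λ ps → cong F (Setoid.refl (𝒮 a) ∷ ps) }

mutual
  curryᵗ : ∀ as t → Func (𝒯 as) (𝒮 t) → El (as ⇒* t)
  curryᵗ []       t F = F ⟨$⟩ []
  curryᵗ (a ∷ as) t F = record
    { to = λ x → curryᵗ as t (fix-head t x F)
    ; cong = λ p → curryᵗ-cong as t (λ _ → cong F (p ∷ ≈ᵗ-refl))
    }

  curryᵗ-cong : ∀ as t {F G : Func (𝒯 as) (𝒮 t)} → Setoid._≈_ (𝒯 as ⇨ 𝒮 t) F G →
                Setoid._≈_ (𝒮 (as ⇒* t)) (curryᵗ as t F) (curryᵗ as t G)
  curryᵗ-cong []       t F≈G   = F≈G []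
  curryᵗ-cong (a ∷ as) t F≈G x = curryᵗ-cong as t (λ xs → F≈G (x ∷ xs))

-- Stated with `≡`, so that `ℐ-⇒-intro` can rewrite inside `ℐ` without first showing that `ℐ`
-- respects equality of realizers.
apply-curryᵗ : ∀ t (F : Func (𝒯 as) (𝒮 t)) xs → apply t (curryᵗ as t F) xs ≡ F ⟨$⟩ xs
apply-curryᵗ t F []       = ≡.refl
apply-curryᵗ t F (x ∷ xs) = apply-curryᵗ t (fix-head t x F) xs

head-cong : ∀ {t} {xs ys : Tuple (t ∷ ts)} → xs ≈ᵗ ys →
            Setoid._≈_ (𝒮 t) (All.head xs) (All.head ys)
head-cong (p ∷ _) = p

tail-cong : ∀ {t} {xs ys : Tuple (t ∷ ts)} → xs ≈ᵗ ys → All.tail xs ≈ᵗ All.tail ys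
tail-cong (_ ∷ ps) = ps

headᶠ : ∀ {A : Setoid 0ℓ 0ℓ} {t} → Func A (𝒯 (t ∷ ts)) → Func A (𝒮 t)
headᶠ F = record { to = λ x → All.head (F ⟨$⟩ x) ; cong = λ p → head-cong (cong F p) }

tailᶠ : ∀ {A : Setoid 0ℓ 0ℓ} {t} → Func A (𝒯 (t ∷ ts)) → Func A (𝒯 ts)
tailᶠ F = record { to = λ x → All.tail (F ⟨$⟩ x) ; cong = λ p → tail-cong (cong F p) }

encode : ∀ ts → Func (𝒯 as) (𝒯 ts) → Tuple (map (as ⇒*_) ts)
encode []       F = []
encode (t ∷ ts) F = curryᵗ _ t (headᶠ F) ∷ encode ts (tailᶠ F)

encode-cong : ∀ ts {F G : Func (𝒯 as) (𝒯 ts)} → Setoid._≈_ (𝒯 as ⇨ 𝒯 ts) F G →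
              encode ts F ≈ᵗ encode ts G
encode-cong []       F≈G = []
encode-cong {as} (t ∷ ts) {F} {G} F≈G =
  curryᵗ-cong as t (λ xs → head-cong (F≈G xs)) ∷ encode-cong ts (λ xs → tail-cong (F≈G xs))

applyTuple-encode : ∀ ts (F : Func (𝒯 as) (𝒯 ts)) xs → applyTuple ts (encode ts F) xs ≡ F ⟨$⟩ xs
applyTuple-encode []       F xs with F ⟨$⟩ xs
... | [] = ≡.refl
applyTuple-encode (t ∷ ts) F xs
  rewrite apply-curryᵗ t (headᶠ F) xs | applyTuple-encode ts (tailᶠ F) xs with F ⟨$⟩ xs
... | _ ∷ _ = ≡.refl

-- Tuples of finite sets

Sets : List StarType → Setoid 0ℓ 0ℓ
Sets ts = 𝒯 (map _⋆ ts)

η : Tuple ts → Tuple (map _⋆ ts)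
η []       = []
η (x ∷ xs) = [ x ] ∷ η xs

η-cong : {xs ys : Tuple ts} → xs ≈ᵗ ys → η xs ≈ᵗ η ys
η-cong []               = []
η-cong {t ∷ _} (p ∷ ps) =
  ((λ { (here q) → here (Setoid.trans (𝒮 t) q p) }) ,
   (λ { (here q) → here (Setoid.trans (𝒮 t) q (Setoid.sym (𝒮 t) p)) })) ∷ η-cong ps

∈-η : (xs : Tuple ts) → xs ∈ᵗ η xs
∈-η {[]}     []       = tt
∈-η {t ∷ _}  (x ∷ xs) = here (Setoid.refl (𝒮 t)) , ∈-η xs

∈ᵗ-resp-≈ : {B C : Tuple (map _⋆ ts)} {x : Tuple ts} → B ≈ᵗ C → x ∈ᵗ B → x ∈ᵗ C
∈ᵗ-resp-≈ {[]}     {x = []}    []                 tt      = tt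
∈ᵗ-resp-≈ {t ∷ ts} {x = _ ∷ _} ((B⊆C , _) ∷ Bs≈Cs) (m , ms) = B⊆C m , ∈ᵗ-resp-≈ Bs≈Cs ms

∈ᵗ-uncons : ∀ {t} {x : El t} {xs : Tuple ts} (B : Tuple (map _⋆ (t ∷ ts))) → (x ∷ xs) ∈ᵗ B →
            Mem (𝒮 t) x (toList (All.head B)) × (xs ∈ᵗ All.tail B)
∈ᵗ-uncons (_ ∷ _) m = m

-- Replaces the quantifier over `b ∈ᵗ B` by a single list, so that a union indexed by all challenges
-- in a box can be formed.
tuples : Tuple (map _⋆ ts) → List (Tuple ts)
tuples {[]}     []       = [] ∷ []
tuples {t ∷ ts} (B ∷ Bs) = cartesianProductWith _∷_ (toList B) (tuples Bs)

∈-tuples⁺ : (B : Tuple (map _⋆ ts)) {x : Tuple ts} → x ∈ᵗ B → Mem (𝒯 ts) x (tuples B)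
∈-tuples⁺ {[]}     []       {[]}    tt       = here []
∈-tuples⁺ {t ∷ ts} (B ∷ Bs) {_ ∷ _} (m , ms) =
  ∈-cartesianProductWith⁺ (𝒮 t) (𝒯 ts) (𝒯 (t ∷ ts)) _∷_ m (∈-tuples⁺ Bs ms)

∈-tuples⁻ : (B : Tuple (map _⋆ ts)) {x : Tuple ts} → Mem (𝒯 ts) x (tuples B) → x ∈ᵗ B
∈-tuples⁻ {[]}     []       {[]}    _ = tt
∈-tuples⁻ {t ∷ ts} (B ∷ Bs) {_ ∷ _} m
  with ∈-cartesianProductWith⁻ (𝒮 t) (𝒯 ts) (𝒯 (t ∷ ts)) _∷_ (toList B) (tuples Bs) m
... | _ , _ , m₁ , m₂ , p ∷ ps =
  ∈-resp-≈ (𝒮 t) (Setoid.sym (𝒮 t) p) m₁ ,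
  ∈-tuples⁻ Bs (∈-resp-≈ (𝒯 ts) (≈ᵗ-sym ps) m₂)

-- Equal sets may be listed differently, so the inclusion goes through `∈ᵗ`, which does not see the
-- listing.
tuples-mono : {B C : Tuple (map _⋆ ts)} → B ≈ᵗ C → Sub (𝒯 ts) (tuples B) (tuples C)
tuples-mono {B = B} {C} B≈C m = ∈-tuples⁺ C (∈ᵗ-resp-≈ B≈C (∈-tuples⁻ B m))

-- join₁ B k cs is B ∪ ⋃_{c ∈ cs} k c, which is non-empty even for empty cs.

module _ {I : Setoid 0ℓ 0ℓ} (t : StarType) where

  join₁ : El (t ⋆) → (Carrier I → El (t ⋆)) → List (Carrier I) → El (t ⋆)
  join₁ B k cs = B ⁺++ concatMap (λ c → toList (k c)) cs

  -- Kept one-sided, so that equality of unions is two instances. `k` and `k′` are compared at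
  -- equivalent indices, because `Sub I cs cs′` only yields an index equivalent to the given one.
  join₁-mono : ∀ {B B′ k k′ cs cs′} → Sub (𝒮 t) (toList B) (toList B′) →
               (∀ {c c′} → Setoid._≈_ I c c′ → Sub (𝒮 t) (toList (k c)) (toList (k′ c′))) →
               Sub I cs cs′ →
               Sub (𝒮 t) (toList (join₁ B k cs)) (toList (join₁ B′ k′ cs′))
  join₁-mono {B} {B′} {k} {k′} {cs} {cs′} B⊆ k⊆ cs⊆ m with Any-++⁻ (toList B) m
  ... | inj₁ m₁ = ++⁺ˡ (B⊆ m₁)
  ... | inj₂ m₂ with find I (concatMap⁻ (λ c → toList (k c)) m₂)
  ... | c , c∈cs , m₃ =
    ++⁺ʳ (toList B′) (concatMap⁺ (λ c → toList (k′ c))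
      (Any.map (λ c≈c′ → k⊆ c≈c′ m₃) (cs⊆ c∈cs)))

module _ {I : Setoid 0ℓ 0ℓ} where

  joinᵗ : Tuple (map _⋆ ts) → Func I (Sets ts) → List (Carrier I) → Tuple (map _⋆ ts)
  joinᵗ {[]}     []       k cs = []
  joinᵗ {t ∷ ts} (B ∷ Bs) k cs = join₁ {I} t B (headᶠ k ⟨$⟩_) cs ∷ joinᵗ Bs (tailᶠ k) cs

  joinᵗ-cong : {B B′ : Tuple (map _⋆ ts)} {k k′ : Func I (Sets ts)} {cs cs′ : List (Carrier I)} →
               B ≈ᵗ B′ → Setoid._≈_ (I ⇨ Sets ts) k k′ → Sub I cs cs′ → Sub I cs′ cs →
               joinᵗ B k cs ≈ᵗ joinᵗ B′ k′ cs′
  joinᵗ-cong {[]}     []                     k≈ cs⊆ cs⊇ = []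
  joinᵗ-cong {t ∷ ts} {k = k} {k′} ((B⊆ , B⊇) ∷ Bs≈) k≈ cs⊆ cs⊇ =
    -- For `c ≈ c′` the first inclusion is k c ⊆ k c′ ⊆ k′ c′; the second exchanges `k` and `k′`.
    ( join₁-mono {I} t B⊆ (λ {_} {c′} p m → proj₁ (head-cong (k≈ c′)) (proj₁ (cong (headᶠ k) p) m)) cs⊆
    , join₁-mono {I} t B⊇ (λ {_} {c′} p m → proj₂ (head-cong (k≈ c′)) (proj₁ (cong (headᶠ k′) p) m)) cs⊇ )
    ∷ joinᵗ-cong Bs≈ (λ c → tail-cong (k≈ c)) cs⊆ cs⊇

  ∈-joinᵗˡ : {B : Tuple (map _⋆ ts)} {k : Func I (Sets ts)} {cs : List (Carrier I)} {x : Tuple ts} →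
             x ∈ᵗ B → x ∈ᵗ joinᵗ B k cs
  ∈-joinᵗˡ {[]}     {[]}    {x = []}    tt       = tt
  ∈-joinᵗˡ {t ∷ ts} {_ ∷ _} {k} {x = _ ∷ _} (m , ms) = ++⁺ˡ m , ∈-joinᵗˡ {k = tailᶠ k} ms

  ∈-joinᵗʳ : (B : Tuple (map _⋆ ts)) (k : Func I (Sets ts)) {c : Carrier I} {cs : List (Carrier I)}
             {x : Tuple ts} → Mem I c cs → x ∈ᵗ (k ⟨$⟩ c) → x ∈ᵗ joinᵗ B k cs
  ∈-joinᵗʳ {[]}     []       k {x = []}    c∈cs m = tt
  ∈-joinᵗʳ {t ∷ ts} (B ∷ Bs) k {c} {cs} {_ ∷ _} c∈cs m =
    let m₁ , m₂ = ∈ᵗ-uncons (k ⟨$⟩ c) m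
    in  ++⁺ʳ (toList B) (concatMap⁺ (λ c → toList (headᶠ k ⟨$⟩ c))
          (Any.map (λ c≈c′ → proj₁ (cong (headᶠ k) c≈c′) m₁) c∈cs))
      , ∈-joinᵗʳ Bs (tailᶠ k) c∈cs m₂

-- Finite sets here are non-empty, so even a variable that does not occur in a term must be
-- challenged by something.
defaultEl : ∀ t → El t
defaultEl nat     = zero
defaultEl bool    = false
defaultEl (ρ ⇒ σ) = record { to = λ _ → defaultEl σ ; cong = λ _ → Setoid.refl (𝒮 σ) }
defaultEl (σ ⋆)   = [ defaultEl σ ]

defaultTuple : ∀ ts → Tuple ts
defaultTuple ts = All.universal defaultEl ts

-- The interpretation of a function type

realizer-⇒ : ∀ ρ σ → Func (𝒯 (τ⁺ ρ)) (𝒯 (τ⁺ σ)) → Func (𝒯 (τ⁺ ρ ++ τ⁻ σ)) (Sets (τ⁻ ρ)) →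
             Tuple (τ⁺ (ρ ⇒ σ))
realizer-⇒ ρ σ F G = ++⁺ (encode (τ⁺ σ) F) (encode (map _⋆ (τ⁻ ρ)) G)

ℐ-⇒-intro : ∀ ρ σ {h : ⟦ ρ ⇒ σ ⟧} F G ad →
            (∀ x → (∀ b → b ∈ᵗ (G ⟨$⟩ ad) → ℐ ρ x (proj₁ (++⁻ (τ⁺ ρ) ad)) b) →
             ℐ σ (h ⟨$⟩ x) (F ⟨$⟩ proj₁ (++⁻ (τ⁺ ρ) ad)) (proj₂ (++⁻ (τ⁺ ρ) ad))) →
            ℐ (ρ ⇒ σ) h (realizer-⇒ ρ σ F G) ad
ℐ-⇒-intro ρ σ F G ad s x hyp
  rewrite ++⁻∘++⁺ (encode (τ⁺ σ) F) (encode (map _⋆ (τ⁻ ρ)) G)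
        | applyTuple-encode (τ⁺ σ) F (proj₁ (++⁻ (τ⁺ ρ) ad))
        | applyTuple-encode (map _⋆ (τ⁻ ρ)) G
            (++⁺ (proj₁ (++⁻ (τ⁺ ρ) ad)) (proj₂ (++⁻ (τ⁺ ρ) {τ⁻ σ} ad)))
  -- `ℐ` evaluates the demand at `ad` split and reassembled, whereas `m` speaks of `ad` itself.
  = s x (λ b m → hyp b (≡.subst (λ ad → b ∈ᵗ (G ⟨$⟩ ad)) (≡.sym (++⁺∘++⁻ (τ⁺ ρ) ad)) m))

realizer-app : ∀ ρ σ → Tuple (τ⁺ (ρ ⇒ σ)) → Tuple (τ⁺ ρ) → Tuple (τ⁺ σ)
realizer-app ρ σ fg a = applyTuple (τ⁺ σ) (proj₁ (++⁻ (map (τ⁺ ρ ⇒*_) (τ⁺ σ)) fg)) a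

demand : ∀ ρ σ → Tuple (τ⁺ (ρ ⇒ σ)) → Tuple (τ⁺ ρ ++ τ⁻ σ) → Tuple (map _⋆ (τ⁻ ρ))
demand ρ σ fg ad = applyTuple (map _⋆ (τ⁻ ρ)) (proj₂ (++⁻ (map (τ⁺ ρ ⇒*_) (τ⁺ σ)) fg)) ad

ℐ-⇒-elim : ∀ ρ σ {h : ⟦ ρ ⇒ σ ⟧} fg a d → ℐ (ρ ⇒ σ) h fg (++⁺ a d) →
           ∀ x → (∀ b → b ∈ᵗ demand ρ σ fg (++⁺ a d) → ℐ ρ x a b) →
           ℐ σ (h ⟨$⟩ x) (realizer-app ρ σ fg a) d
ℐ-⇒-elim ρ σ fg a d s x hyp rewrite ++⁻∘++⁺ a d = s x hyp

-- At a function type the premise concerns only the argument, so equality is needed for the values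
-- alone.
ℐ-resp-≈ : ∀ σ {x y : ⟦ σ ⟧} {a b} → x ≈[ σ ] y → ℐ σ x a b → ℐ σ y a b
ℐ-resp-≈ nat     {a = _ ∷ []} {[]} x≈y x≡n = ≡.trans (≡.sym x≈y) x≡n
ℐ-resp-≈ bool    {a = _ ∷ []} {[]} x≈y x≡n = ≡.trans (≡.sym x≈y) x≡n
ℐ-resp-≈ (ρ ⇒ σ) x≈y s z hyp = ℐ-resp-≈ σ (x≈y z) (s z hyp)

-- Realizability in context

Ctx : Set
Ctx = List FinType

private
  variable
    Γ : Ctx

Env : Ctx → Set
Env []      = ⊤
Env (ρ ∷ Γ) = Env Γ × ⟦ ρ ⟧

-- 𝒫 collects realizers, and 𝒟 finite sets of challenges, for the variables.

𝒫 : Ctx → Setoid 0ℓ 0ℓ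
𝒫 []      = ⊤-setoid
𝒫 (ρ ∷ Γ) = 𝒫 Γ ×ₛ 𝒯 (τ⁺ ρ)

𝒟 : Ctx → Setoid 0ℓ 0ℓ
𝒟 []      = ⊤-setoid
𝒟 (ρ ∷ Γ) = 𝒟 Γ ×ₛ Sets (τ⁻ ρ)

Sat : ∀ Γ → Env Γ → Carrier (𝒫 Γ) → Carrier (𝒟 Γ) → Set
Sat []      _       _       _       = ⊤
Sat (ρ ∷ Γ) (e , x) (p , a) (D , B) = Sat Γ e p D × (∀ b → b ∈ᵗ B → ℐ ρ x a b)

default𝒟 : ∀ Γ → Carrier (𝒟 Γ)
default𝒟 []      = tt
default𝒟 (ρ ∷ Γ) = default𝒟 Γ , η (defaultTuple (τ⁻ ρ))

fstᶠ : ∀ {A B C : Setoid 0ℓ 0ℓ} → Func A (B ×ₛ C) → Func A B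
fstᶠ F = record { to = λ x → proj₁ (F ⟨$⟩ x) ; cong = λ p → proj₁ (cong F p) }

sndᶠ : ∀ {A B C : Setoid 0ℓ 0ℓ} → Func A (B ×ₛ C) → Func A C
sndᶠ F = record { to = λ x → proj₂ (F ⟨$⟩ x) ; cong = λ p → proj₂ (cong F p) }

module _ {I : Setoid 0ℓ 0ℓ} where

  join : ∀ Γ → Carrier (𝒟 Γ) → Func I (𝒟 Γ) → List (Carrier I) → Carrier (𝒟 Γ)
  join []      _       k cs = tt
  join (ρ ∷ Γ) (D , B) k cs = join Γ D (fstᶠ k) cs , joinᵗ B (sndᶠ k) cs

  join-cong : ∀ Γ {D D′ k k′ cs cs′} → Setoid._≈_ (𝒟 Γ) D D′ → Setoid._≈_ (I ⇨ 𝒟 Γ) k k′ →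
              Sub I cs cs′ → Sub I cs′ cs →
              Setoid._≈_ (𝒟 Γ) (join Γ D k cs) (join Γ D′ k′ cs′)
  join-cong []      _         k≈ cs⊆ cs⊇ = ≡.refl
  join-cong (ρ ∷ Γ) {k = k} {k′} (D≈ , B≈) k≈ cs⊆ cs⊇ =
    join-cong Γ {k = fstᶠ k} {fstᶠ k′} D≈ (λ c → proj₁ (k≈ c)) cs⊆ cs⊇ ,
    joinᵗ-cong {k = sndᶠ k} {sndᶠ k′} B≈ (λ c → proj₂ (k≈ c)) cs⊆ cs⊇

  -- `Sat` is antitone in the challenge sets: whatever meets a union meets each of its parts.
  Sat-joinˡ : ∀ Γ {e p D} {k : Func I (𝒟 Γ)} {cs} → Sat Γ e p (join Γ D k cs) → Sat Γ e p D
  Sat-joinˡ []      _        = tt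
  Sat-joinˡ (ρ ∷ Γ) {k = k} (s , t) =
    Sat-joinˡ Γ {k = fstᶠ k} s , λ b m → t b (∈-joinᵗˡ {k = sndᶠ k} m)

  Sat-joinʳ : ∀ Γ {e p D} {k : Func I (𝒟 Γ)} {c cs} → Sat Γ e p (join Γ D k cs) →
              Mem I c cs → Sat Γ e p (k ⟨$⟩ c)
  Sat-joinʳ []      _       c∈cs = tt
  Sat-joinʳ (ρ ∷ Γ) {D = _ , B} {k} (s , t) c∈cs =
    Sat-joinʳ Γ {k = fstᶠ k} s c∈cs , λ b m → t b (∈-joinᵗʳ B (sndᶠ k) c∈cs m)

infix 3 Realizes

-- As with f and g in `ℐ`, `pos` and `neg` depend on the realizers of the variables, never on their
-- values `e`.
record Realizes (Γ : Ctx) (σ : FinType) (h : Env Γ → ⟦ σ ⟧) : Set where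
  field
    pos   : Func (𝒫 Γ) (𝒯 (τ⁺ σ))
    neg   : Func (𝒫 Γ ×ₛ 𝒯 (τ⁻ σ)) (𝒟 Γ)
    sound : ∀ e p d → Sat Γ e p (neg ⟨$⟩ (p , d)) → ℐ σ (h e) (pos ⟨$⟩ p) d

open Realizes

syntax Realizes Γ σ h = Γ ⊩[ σ ] h

-- The rules of the simply typed λ-calculus.

const : ∀ x → x ∈ 𝒞⁼ σ → Γ ⊩[ σ ] λ _ → x
const {Γ = Γ} x (a , r) = record
  { pos   = record { to = λ _ → a ; cong = λ _ → ≈ᵗ-refl }
  ; neg   = record { to = λ _ → default𝒟 Γ ; cong = λ _ → Setoid.refl (𝒟 Γ) }
  ; sound = λ _ _ d _ → r d
  }

closed : ∀ x → [] ⊩[ σ ] (λ _ → x) → x ∈ 𝒞⁼ σ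
closed x t = pos t ⟨$⟩ tt , λ d → sound t tt tt d tt

-- A challenge to the term is passed on to the variable as a singleton; the other variables get
-- default challenges.
var₀ : (ρ ∷ Γ) ⊩[ ρ ] proj₂
var₀ {Γ = Γ} = record
  { pos   = record { to = proj₂ ; cong = proj₂ }
  ; neg   = record
    { to = λ (_ , d) → default𝒟 Γ , η d
    ; cong = λ (_ , d≈) → Setoid.refl (𝒟 Γ) , η-cong d≈
    }
  ; sound = λ _ _ d (_ , s) → s d (∈-η d)
  }

weaken : ∀ {h} → Γ ⊩[ σ ] h → (ρ ∷ Γ) ⊩[ σ ] (λ (e , _) → h e)
weaken {ρ = ρ} t = record
  { pos   = record { to = λ (p , _) → pos t ⟨$⟩ p ; cong = λ (p≈ , _) → cong (pos t) p≈ }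
  ; neg   = record
    { to = λ ((p , _) , d) → (neg t ⟨$⟩ (p , d)) , η (defaultTuple (τ⁻ ρ))
    ; cong = λ ((p≈ , _) , d≈) → cong (neg t) (p≈ , d≈) , ≈ᵗ-refl
    }
  ; sound = λ (e , _) (p , _) d (s , _) → sound t e p d s
  }

-- The answer of `t` is split: its sets for the bound variable become the g-part of the realizer,
-- its sets for `Γ` stay in `neg`.
lam : ∀ {h : Env Γ → ⟦ ρ ⇒ σ ⟧} → (ρ ∷ Γ) ⊩[ σ ] (λ (e , x) → h e ⟨$⟩ x) → Γ ⊩[ ρ ⇒ σ ] h
lam {Γ} {ρ} {σ} {h} t = record
  { pos   = record
    { to   = λ p → realizer-⇒ ρ σ (F p) (G p)
    ; cong = λ p≈ → ++⁺-cong
        (encode-cong (τ⁺ σ) (λ a → cong (pos t) (p≈ , ≈ᵗ-refl)))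
        (encode-cong (map _⋆ (τ⁻ ρ)) (λ ad → proj₂ (cong (neg t) ((p≈ , ≈ᵗ-refl) , ≈ᵗ-refl))))
    }
  ; neg   = record
    { to   = λ (p , ad) → proj₁ (N p ad)
    ; cong = λ (p≈ , ad≈) →
        let a≈ , d≈ = ++⁻-cong (τ⁺ ρ) ad≈ in proj₁ (cong (neg t) ((p≈ , a≈) , d≈))
    }
  ; sound = λ e p ad s → ℐ-⇒-intro ρ σ {h e} (F p) (G p) ad
      (λ x hyp → sound t (e , x) (p , _) _ (s , hyp))
  }
  where
  N : Carrier (𝒫 Γ) → Tuple (τ⁺ ρ ++ τ⁻ σ) → Carrier (𝒟 (ρ ∷ Γ))
  N p ad = let a , d = ++⁻ (τ⁺ ρ) ad in neg t ⟨$⟩ ((p , a) , d)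

  F : Carrier (𝒫 Γ) → Func (𝒯 (τ⁺ ρ)) (𝒯 (τ⁺ σ))
  F p = record
    { to = λ a → pos t ⟨$⟩ (p , a) ; cong = λ a≈ → cong (pos t) (Setoid.refl (𝒫 Γ) , a≈) }

  G : Carrier (𝒫 Γ) → Func (𝒯 (τ⁺ ρ ++ τ⁻ σ)) (Sets (τ⁻ ρ))
  G p = record
    { to = λ ad → proj₂ (N p ad)
    ; cong = λ ad≈ →
        let a≈ , d≈ = ++⁻-cong (τ⁺ ρ) ad≈
        in  proj₂ (cong (neg t) ((Setoid.refl (𝒫 Γ) , a≈) , d≈))
    }

-- With a the realizer from `u`, a challenge d to the value becomes the challenge (a, d) to the
-- function. The function then demands a finite box of challenges to the argument, and `u` answers
-- each of them. The union of all these answers with that of `t` covers both premises of soundness.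
app : ∀ {h k} → Γ ⊩[ ρ ⇒ σ ] h → Γ ⊩[ ρ ] k → Γ ⊩[ σ ] (λ e → h e ⟨$⟩ k e)
app {Γ} {ρ} {σ} {h} t u = record
  { pos   = record
    { to   = λ p → realizer-app ρ σ (pos t ⟨$⟩ p) (pos u ⟨$⟩ p)
    ; cong = λ p≈ → applyTuple-cong (τ⁺ σ)
        (proj₁ (++⁻-cong (map (τ⁺ ρ ⇒*_) (τ⁺ σ)) (cong (pos t) p≈))) (cong (pos u) p≈)
    }
  ; neg   = record
    { to   = λ (p , d) →
        join Γ (neg t ⟨$⟩ (p , ++⁺ (pos u ⟨$⟩ p) d)) (negᵤ p) (tuples (demandₜ p d))
    ; cong = λ {(p , d)} {(p′ , d′)} (p≈ , d≈) →
        join-cong Γ {k = negᵤ p} {negᵤ p′}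
          (cong (neg t) (p≈ , ++⁺-cong (cong (pos u) p≈) d≈))
          (λ c → cong (neg u) (p≈ , ≈ᵗ-refl))
          (tuples-mono (demandₜ-cong p≈ d≈))
          (tuples-mono (≈ᵗ-sym (demandₜ-cong p≈ d≈)))
    }
  ; sound = λ e p d s →
      ℐ-⇒-elim ρ σ {h e} (pos t ⟨$⟩ p) (pos u ⟨$⟩ p) d
        (sound t e p _ (Sat-joinˡ Γ {k = negᵤ p} s)) _
        (λ c c∈ → sound u e p c
          (Sat-joinʳ Γ {k = negᵤ p} s (∈-tuples⁺ (demandₜ p d) c∈)))
  }
  where
  negᵤ : Carrier (𝒫 Γ) → Func (𝒯 (τ⁻ ρ)) (𝒟 Γ)
  negᵤ p = record
    { to = λ c → neg u ⟨$⟩ (p , c) ; cong = λ c≈ → cong (neg u) (Setoid.refl (𝒫 Γ) , c≈) }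

  demandₜ : Carrier (𝒫 Γ) → Tuple (τ⁻ σ) → Tuple (map _⋆ (τ⁻ ρ))
  demandₜ p d = demand ρ σ (pos t ⟨$⟩ p) (++⁺ (pos u ⟨$⟩ p) d)

  demandₜ-cong : ∀ {p p′ d d′} → Setoid._≈_ (𝒫 Γ) p p′ → d ≈ᵗ d′ → demandₜ p d ≈ᵗ demandₜ p′ d′
  demandₜ-cong p≈ d≈ = applyTuple-cong (map _⋆ (τ⁻ ρ))
    (proj₂ (++⁻-cong (map (τ⁺ ρ ⇒*_) (τ⁺ σ)) (cong (pos t) p≈)))
    (++⁺-cong (cong (pos u) p≈) d≈)

-- Membership of the constants and closure under application.

nat⇒∈ : ∀ σ (h : ⟦ nat ⇒ σ ⟧) → (∀ n → h ⟨$⟩ n ∈ 𝒞⁼ σ) → h ∈ 𝒞⁼ (nat ⇒ σ)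
nat⇒∈ σ h r = realizer-⇒ nat σ F G , λ { ad@(_ ∷ d) →
  -- `τ⁻ nat` is empty, so `hyp [] tt` is the equation of `x` with the numeral in `ad`; hence only
  -- the realizer chosen for that numeral matters.
  ℐ-⇒-intro nat σ {h} F G ad (λ x hyp → s x d (hyp [] tt)) }
  where
  F : Func (𝒯 (nat ∷ [])) (𝒯 (τ⁺ σ))
  F = record
    { to = λ as → proj₁ (r (All.head as)) ; cong = λ { (≡.refl ∷ []) → ≈ᵗ-refl } }

  G : Func (𝒯 (nat ∷ τ⁻ σ)) (𝒯 [])
  G = record { to = λ _ → [] ; cong = λ _ → [] }

  s : ∀ x {n} d → x ≡ n → ℐ σ (h ⟨$⟩ x) (proj₁ (r n)) d
  s x d ≡.refl = proj₂ (r x) d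

-- The realizer of `x` withstands every challenge, in particular those demanded by `h`.
app∈ : ∀ ρ σ {h : ⟦ ρ ⇒ σ ⟧} {x : ⟦ ρ ⟧} → h ∈ 𝒞⁼ (ρ ⇒ σ) → x ∈ 𝒞⁼ ρ → h ⟨$⟩ x ∈ 𝒞⁼ σ
app∈ ρ σ {h} {x} (fg , r) (a , s) =
  realizer-app ρ σ fg a , λ d → ℐ-⇒-elim ρ σ {h} fg a d (r (++⁺ a d)) x (λ b _ → s b)

nat∈ : ∀ n → n ∈ 𝒞⁼ nat
nat∈ n = n ∷ [] , λ { [] → ≡.refl }

rec∈ : ∀ σ n → 𝐑 σ ⟨$⟩ n ∈ 𝒞⁼ (σ ⇒ (nat ⇒ σ ⇒ σ) ⇒ σ)
-- The terms are λw f. w and λw f. f n (R n w f), with f as `var₀`; `𝐑 σ ⟨$⟩ n` enters the second as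
-- a constant realized by the induction hypothesis.
rec∈ σ zero    = closed (𝐑 σ ⟨$⟩ zero) (lam (lam (weaken var₀)))
rec∈ σ (suc n) = closed (𝐑 σ ⟨$⟩ suc n) (lam (lam
  (app (app var₀ (const n (nat∈ n))) (app (app (const (𝐑 σ ⟨$⟩ n) (rec∈ σ n)) (weaken var₀)) var₀))))

proposition7p9 : IsModelOfT 𝒞⁼
proposition7p9 = record
  { respects   = λ σ x≈y (a , r) → a , λ b → ℐ-resp-≈ σ x≈y (r b)
  ; nat-full   = nat∈
  ; app-closed = app∈
  ; 𝚷∈         = λ {ρ} {σ} _ _ → closed (𝚷 ρ σ) (lam (lam (weaken var₀)))
  -- The term is λx y z. x z (y z), with z as `var₀`.
  ; 𝚺∈         = λ {ρ} {σ} {τ} _ _ _ → closed (𝚺 ρ σ τ) (lam (lam (lam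
                   (app (app (weaken (weaken var₀)) var₀) (app (weaken var₀) var₀)))))
  ; 𝟎∈         = nat∈ zero
  ; 𝐒∈         = nat⇒∈ nat 𝐒 (λ n → nat∈ (suc n))
  ; 𝐑∈         = λ {σ} _ → nat⇒∈ (σ ⇒ (nat ⇒ σ ⇒ σ) ⇒ σ) (𝐑 σ) (rec∈ σ)
  -- In each defining equation both sides are definitionally equal.
  ; 𝚷-eq       = λ {ρ} _ _ _ _ → Setoid.refl (𝒮 ⌊ ρ ⌋)
  ; 𝚺-eq       = λ {_} {_} {τ} _ _ _ _ _ _ → Setoid.refl (𝒮 ⌊ τ ⌋)
  ; 𝐑-zero     = λ {σ} _ _ _ → Setoid.refl (𝒮 ⌊ σ ⌋)
  ; 𝐑-suc      = λ {σ} _ _ _ _ → Setoid.refl (𝒮 ⌊ σ ⌋)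
  }
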